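{- Let $G$ be a graph on $n \geq 3$ vertices such that $G$ and its complement $\overline{G}$ are both connected. Then $$b_{\rm g}'(G)\, b_{\rm g}'(\overline{G}) \leq n+21.$$
   Context: All graphs are finite, simple and undirected. The burning game on a graph $G$ is played by two players, Burner and Staller, in rounds $t=1,2,3,\dots$. Initially (round $0$) all vertices are unburned. Each round $t\ge 1$ consists of two phases: first, in the spreading phase, every unburned vertex having a burning neighbor starts to burn (fire spreads simultaneously, by distance one, from all burning vertices); then, in the selection phase, if unburned vertices remain, the player whose turn it is chooses one unburned vertex, which starts to burn. Burning vertices stay burning forever. The players alternate: one of them selects in the odd rounds, the other in the even rounds. The game ends in the first round in which all vertices of $G$ are burning (possibly already after the spreading phase of that round). Burner wants to minimize the number of rounds and Staller wants to maximize it. If both play optimally, the number of rounds is denoted $b_{\rm g}'(G)$ (the Staller-start game burning number) when Staller makes the first move (selects in round 1). -}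

module Defs where

open import Data.Bool using (true; false; if_then_else_)
open import Data.Fin using (Fin)
open import Data.Fin.Properties using (_≟_; any?)
open import Data.Fin.Subset using (Subset; _∈_; _∉_; _⊆_; _∪_; ⁅_⁆; ⊥; ∣_∣)
open import Data.Fin.Subset.Properties
  using (_∈?_; ∈⊤; ∣p∣≤n; ∣p∣≡n⇒p≡⊤; x∈⁅x⁆; p⊆p∪q; q⊆p∪q; p⊂q⇒∣p∣<∣q∣)
open import Data.List using (List; []; _∷_; map; filter; null; allFin)
open import Data.List.Extrema.Nat using (min; max)
open import Data.List.Properties using (filter-none; map-cong-local)
open import Data.List.Relation.Unary.All using (All; []; _∷_; universal)
import Data.List.Relation.Unary.All as All
open import Data.List.Relation.Unary.All.Properties using (all-filter)
open import Data.Nat using (ℕ; zero; suc; _+_; _≤_)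
open import Data.Nat.Properties
  using (≤-antisym; ≤-trans; ≤-reflexive; +-suc; +-monoʳ-≤; m≤m+n)
open import Data.Product using (∃; _×_; _,_)
open import Data.Sum using (_⊎_; inj₁)
open import Data.Vec using (tabulate)
open import Data.Vec.Properties using (lookup∘tabulate; lookup⇒[]=)
open import Function using (_∘_)
open import Level using (0ℓ)
open import Relation.Binary.Core using (Rel)
open import Relation.Binary.Construct.Closure.ReflexiveTransitive using (Star)
open import Relation.Binary.Definitions using (Decidable; Irreflexive; Symmetric)
open import Relation.Binary.PropositionalEquality
  using (_≡_; _≢_; refl; sym; trans; cong; cong₂; subst)
open import Relation.Nullary using (Dec; ¬_; does)
open import Relation.Nullary.Decidable using (¬?; _×-dec_; _⊎-dec_; dec-true)

record Graph (n : ℕ) : Set₁ where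
  infix 4 _~_ _~?_
  field
    _~_      : Rel (Fin n) 0ℓ
    ~-sym    : Symmetric _~_
    ~-irrefl : Irreflexive _≡_ _~_
    _~?_     : Decidable _~_

complement : ∀ {n} → Graph n → Graph n
complement G = record
  { _~_      = λ u v → u ≢ v × ¬ u ~ v
  ; ~-sym    = λ (u≢v , u≁v) → u≢v ∘ sym , u≁v ∘ ~-sym
  ; ~-irrefl = λ u≡v (u≢v , _) → u≢v u≡v
  ; _~?_     = λ u v → ¬? (u ≟ v) ×-dec ¬? (u ~? v)
  }
  where open Graph G

Connected : ∀ {n} → Graph n → Set
Connected G = ∀ u v → Star (Graph._~_ G) u v

data Player : Set where
  burner staller : Player

opponent : Player → Player
opponent burner  = staller
opponent staller = burner

-- The clause for [] is reached only when the spreading phase has burned every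
-- vertex: nothing is selected and no further round is played.
best : ∀ {A : Set} → Player → (A → ℕ) → List A → ℕ
best _       f []       = 0
best burner  f (v ∷ vs) = min (f v) (map f vs)
best staller f (v ∷ vs) = max (f v) (map f vs)

unburned : ∀ {n} → Subset n → List (Fin n)
unburned B = filter (λ v → ¬? (v ∈? B)) (allFin _)

module _ {n : ℕ} (G : Graph n) where
  open Graph G

  catches? : ∀ B v → Dec (v ∈ B ⊎ ∃ λ u → u ∈ B × u ~ v)
  catches? B v = v ∈? B ⊎-dec any? (λ u → u ∈? B ×-dec u ~? v)

  spread : Subset n → Subset n
  spread B = tabulate λ v → does (catches? B v)

  -- One round of the game, played from the set B of burning vertices with p
  -- to select; R gives the number of rounds that follow this one.
  playRound : (Player → Subset n → ℕ) → Player → Subset n → ℕ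
  playRound R p B =
    if null (unburned B)
    then 0
    else suc (best p (λ v → R (opponent p) (spread B ∪ ⁅ v ⁆))
                     (unburned (spread B)))

  -- Optimal play cut off after k rounds.
  roundsUpTo : ℕ → Player → Subset n → ℕ
  roundsUpTo zero    _ _ = 0
  roundsUpTo (suc k)     = playRound (roundsUpTo k)

  -- The cut-off at n is never felt, since every round burns a new vertex;
  -- see rounds-unfold.
  rounds : Player → Subset n → ℕ
  rounds = roundsUpTo n

  gameBurningNumber′ : ℕ
  gameBurningNumber′ = rounds staller ⊥

best-cong : ∀ {A : Set} p {f g : A → ℕ} {vs} →
            All (λ v → f v ≡ g v) vs → best p f vs ≡ best p g vs
best-cong _       []         = refl
best-cong burner  (eq ∷ eqs) = cong₂ min eq (map-cong-local eqs)
best-cong staller (eq ∷ eqs) = cong₂ max eq (map-cong-local eqs)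

unburned-full : ∀ {n} (B : Subset n) → n ≤ ∣ B ∣ → unburned B ≡ []
unburned-full B n≤∣B∣
  rewrite ∣p∣≡n⇒p≡⊤ {p = B} (≤-antisym (∣p∣≤n B) n≤∣B∣) =
  filter-none (λ v → ¬? (v ∈? _)) (universal (λ _ v∉⊤ → v∉⊤ ∈⊤) (allFin _))

module _ {n : ℕ} (G : Graph n) where

  spread-⊇ : ∀ B → B ⊆ spread G B
  spread-⊇ B {v} v∈B = lookup⇒[]= v (spread G B)
    (trans (lookup∘tabulate _ v) (dec-true (catches? G B v) (inj₁ v∈B)))

  roundsUpTo-stable : ∀ k p B → n ≤ k + ∣ B ∣ →
                      roundsUpTo G k p B ≡ roundsUpTo G (suc k) p B
  roundsUpTo-stable zero    p B n≤ rewrite unburned-full B n≤ = refl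
  roundsUpTo-stable (suc k) p B n≤ with null (unburned B)
  ... | true  = refl
  ... | false = cong suc (best-cong p (All.map next (all-filter _ (allFin n))))
    where
    next : ∀ {v} → v ∉ spread G B →
           roundsUpTo G k (opponent p) (spread G B ∪ ⁅ v ⁆) ≡
           roundsUpTo G (suc k) (opponent p) (spread G B ∪ ⁅ v ⁆)
    next {v} v∉ = roundsUpTo-stable k (opponent p) _
      (≤-trans n≤ (≤-trans (≤-reflexive (sym (+-suc k ∣ B ∣)))
        (+-monoʳ-≤ k (p⊂q⇒∣p∣<∣q∣
          ( (λ u∈B → p⊆p∪q ⁅ v ⁆ (spread-⊇ B u∈B))
          , v , q⊆p∪q (spread G B) ⁅ v ⁆ (x∈⁅x⁆ v) , v∉ ∘ spread-⊇ B)))))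

  rounds-unfold : ∀ p B → rounds G p B ≡ playRound G (rounds G) p B
  rounds-unfold p B = roundsUpTo-stable n p B (m≤m+n n ∣ B ∣)

{-# OPTIONS --safe #-}
-- If diam Ḡ > 2, then some edge uv of G dominates G, so diam G ≤ 3; the same
-- holds with G and Ḡ exchanged. As b′ ≤ diam + 1, either both diameters are at
-- most 3 and the product is at most 16, or one factor is at most 3. It remains
-- to see that 3 b′(G) ≤ n + 12 for every connected G. Put r = ⌊n/3⌋, root a
-- breadth-first tree at the vertex v of Staller's first move, and repeat twice:
-- take a deepest vertex w outside the r-balls chosen so far (starting from the
-- ball around v) and add the r-ball around the r-th ancestor of w. A third such
-- w cannot exist, since the three paths from the w's to their r-th ancestors
-- would be disjoint and have 3 (r + 1) > n vertices. Burner thus selects the two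
-- centres in rounds 2 and 4, and everything burns by round r + 4.
module Submission where

open import Defs
open import Data.Bool using (true; false)
open import Data.Fin using (Fin; zero; suc; toℕ; remQuot; combine)
import Data.Fin as Fin
open import Data.Fin.Properties
  using (_≟_; any?; all?; ¬∀⟶∃¬; pigeonhole; combine-remQuot; toℕ-injective; toℕ≤pred[n])
import Data.Fin.Properties as Fin
open import Data.Fin.Subset using (_∈_; _⊆_; _∪_; ⁅_⁆; ⊥)
open import Data.Fin.Subset.Properties using (_∈?_; x∈⁅x⁆; p⊆p∪q; q⊆p∪q)
open import Data.List using ([]; _∷_; filter; map; null; allFin)
import Data.List.Membership.Propositional as List
open import Data.List.Extrema.Nat using (max≤v⁺; min≤v⁺; argmax; argmax-all; f[xs]≤f[argmax])
open import Data.List.Membership.Propositional.Properties using (∈-filter⁺; ∈-allFin)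
open import Data.List.Properties using (filter-none)
open import Data.List.Relation.Unary.All using (All; []; _∷_; universal)
import Data.List.Relation.Unary.All as All
open import Data.List.Relation.Unary.All.Properties using (all-filter; map⁺)
open import Data.List.Relation.Unary.Any using (here; there)
import Data.List.Relation.Unary.Any as Any
import Data.List.Relation.Unary.Any.Properties as Any
open import Data.Nat using (ℕ; zero; suc; pred; _+_; _*_; _∸_; _≤_; _<_; z≤n; s≤s; s≤s⁻¹; _/_; _%_)
open import Data.Nat.DivMod using (m≡m%n+[m/n]*n; m%n<n; m/n*n≤m)
open import Data.Nat.Properties
  using ( ≤-reflexive; ≤-trans; ≤-antisym; _≤?_; ≰⇒>; ≰⇒≥; ≮⇒≥; <⇒≢; <⇒≱; <-≤-trans
        ; m≤m+n; m≤n+m; +-comm; +-monoˡ-≤; +-monoʳ-≤; +-monoˡ-<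
        ; *-comm; *-distribˡ-+; *-mono-≤; *-monoˡ-≤; *-monoʳ-≤
        ; ∸-monoʳ-<; ∸-monoˡ-≤; ∸-cancelˡ-≡; pred[m∸n]≡m∸[1+n]; m+[n∸m]≡n; m∸n+n≡m
        ; module ≤-Reasoning )
open import Data.Product using (uncurry; ∃; ∃₂; _×_; _,_; proj₁; proj₂)
open import Data.Sum using (_⊎_; inj₁; inj₂)
open import Data.Vec.Properties using (lookup∘tabulate; lookup⇒[]=)
open import Function using (_∘_)
open import Function.Endo.Propositional using (_^_; ^-homo)
open import Relation.Binary.Construct.Closure.ReflexiveTransitive using (Star; ε; _◅_)
open import Relation.Binary.Definitions using (tri<; tri≈; tri>)
open import Relation.Binary.PropositionalEquality
  using (_≡_; _≢_; refl; sym; trans; cong; cong-app; subst; module ≡-Reasoning)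
open import Relation.Nullary using (Dec; yes; no; ¬_; contradiction)
open import Relation.Nullary.Decidable using (¬?; _×-dec_; dec-true; decidable-stable; map′)

-- Finite search and the value of a best move.

least : ∀ {P : ℕ → Set} → (∀ k → Dec (P k)) → ∀ m → P m → ∃ λ k → P k × ∀ j → P j → k ≤ j
least P? m pm with P? 0
least P? m       pm | yes p₀ = 0 , p₀ , λ _ _ → z≤n
least P? zero    pm | no ¬p₀ = contradiction pm ¬p₀
least P? (suc m) pm | no ¬p₀ with k , pk , min ← least (P? ∘ suc) m pm =
  suc k , pk , λ { zero p₀ → contradiction p₀ ¬p₀ ; (suc j) pj → s≤s (min j pj) }

maximal : ∀ {n} {P : Fin n → Set} (f : Fin n → ℕ) → (∀ v → Dec (P v)) →
          (∀ v → ¬ P v) ⊎ ∃ λ v → P v × ∀ u → P u → f u ≤ f v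
maximal f P? with any? P?
... | no ∄         = inj₁ λ v pv → ∄ (v , pv)
... | yes (v , pv) = inj₂
  -- The default of `argmax` is the witness `v`, which satisfies `P`; hence so does the result,
  -- whichever vertex it is.
  ( argmax f v vs
  , argmax-all f pv (all-filter P? (allFin _))
  , λ u pu → All.lookup (f[xs]≤f[argmax] v vs) (∈-filter⁺ P? (∈-allFin u) pu) )
  where vs = filter P? (allFin _)

best-≤ : ∀ {A : Set} p (f : A → ℕ) {m} vs → All (λ v → f v ≤ m) vs → best p f vs ≤ m
best-≤ _       f []       []       = z≤n
best-≤ burner  f (v ∷ vs) (h ∷ hs) = min≤v⁺ (f v) (map f vs) (inj₁ h)
best-≤ staller f (v ∷ vs) (h ∷ hs) = max≤v⁺ h (map⁺ hs)

best-burner-≤ : ∀ {A : Set} (f : A → ℕ) {m v} {vs} → v List.∈ vs → f v ≤ m →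
                best burner f vs ≤ m
best-burner-≤ f {vs = v ∷ vs} (here refl) h = min≤v⁺ (f v) (map f vs) (inj₁ h)
best-burner-≤ f {m} {vs = v ∷ vs} (there x∈) h =
  min≤v⁺ (f v) (map f vs) (inj₂ (Any.map⁺ (Any.map (λ { refl → h }) x∈)))

-- Distances in a graph.

module _ {n : ℕ} (G : Graph n) where
  open Graph G

  -- Since `here` is available at every index, the relation means distance at most `k`, not a walk
  -- of exactly `k` edges.
  data Within : ℕ → Fin n → Fin n → Set where
    here : ∀ {k u} → Within k u u
    step : ∀ {k u w v} → u ~ w → Within k w v → Within (suc k) u v

module _ {n : ℕ} {G : Graph n} where
  open Graph G

  within? : ∀ k u v → Dec (Within G k u v)
  within? zero u v = map′ (λ { refl → here }) (λ { here → refl }) (u ≟ v)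
  within? (suc k) u v with u ≟ v
  ... | yes refl = yes here
  ... | no u≢v   = map′ (λ (_ , e , p) → step e p)
    (λ { here → contradiction refl u≢v ; (step e p) → _ , e , p })
    (any? λ w → u ~? w ×-dec within? k w v)

  within-mono : ∀ {k l u v} → k ≤ l → Within G k u v → Within G l u v
  within-mono _         here       = here
  within-mono (s≤s k≤l) (step e p) = step e (within-mono k≤l p)

  within-trans : ∀ {k l u v w} → Within G k u v → Within G l v w → Within G (k + l) u w
  within-trans {k} {l} here q = within-mono (m≤n+m l k) q
  within-trans (step e p)   q = step e (within-trans p q)

  within-sym : ∀ {k u v} → Within G k u v → Within G k v u
  within-sym here               = here
  within-sym {suc k} (step e p) =
    within-mono (≤-reflexive (+-comm k 1)) (within-trans (within-sym p) (step (~-sym e) here))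

  star⇒within : ∀ {u v} → Star _~_ u v → ∃ λ k → Within G k u v
  star⇒within ε       = 0 , here
  star⇒within (e ◅ s) with k , p ← star⇒within s = suc k , step e p

-- Upper bounds on the length of the game.

module _ {n : ℕ} (G : Graph n) where
  open Graph G

  spread-~ : ∀ B {u v} → u ∈ B → u ~ v → v ∈ spread G B
  spread-~ B {v = v} u∈B e = lookup⇒[]= v (spread G B)
    (trans (lookup∘tabulate _ v) (dec-true (catches? G B v) (inj₂ (_ , u∈B , e))))

  playRound-≤ : ∀ R p B {m} →
    best p (λ v → R (opponent p) (spread G B ∪ ⁅ v ⁆)) (unburned (spread G B)) ≤ m →
    playRound G R p B ≤ suc m
  playRound-≤ R p B h with null (unburned B)
  ... | true  = z≤n
  ... | false = s≤s h

  -- The bound is asked of every `v`, burning or not, so it serves either player and no membership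
  -- in `unburned` has to be carried along.
  rounds-≤ : ∀ p B {m} →
    (∀ v → rounds G (opponent p) (spread G B ∪ ⁅ v ⁆) ≤ m) → rounds G p B ≤ suc m
  rounds-≤ p B h = subst (_≤ _) (sym (rounds-unfold G p B))
    (playRound-≤ (rounds G) p B (best-≤ p _ _ (universal h (unburned (spread G B)))))

  -- If the vertex c aimed at burns already, then Burner selects any vertex.
  rounds-burner-≤ : ∀ B c {m} →
    (∀ B′ → B ⊆ B′ → c ∈ B′ → rounds G staller B′ ≤ m) → rounds G burner B ≤ suc m
  rounds-burner-≤ B c h with c ∈? spread G B
  ... | yes c∈ = rounds-≤ burner B λ v →
    h _ (p⊆p∪q ⁅ v ⁆ ∘ spread-⊇ G B) (p⊆p∪q ⁅ v ⁆ c∈)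
  ... | no c∉ = subst (_≤ _) (sym (rounds-unfold G burner B))
    (playRound-≤ (rounds G) burner B (best-burner-≤ _
      (∈-filter⁺ (λ v → ¬? (v ∈? spread G B)) (∈-allFin c) c∉)
      (h _ (p⊆p∪q ⁅ c ⁆ ∘ spread-⊇ G B) (q⊆p∪q (spread G B) ⁅ c ⁆ (x∈⁅x⁆ c)))))

  rounds-full : ∀ p B → (∀ v → v ∈ B) → rounds G p B ≡ 0
  rounds-full p B full = trans (rounds-unfold G p B) eq
    where
    eq : playRound G (rounds G) p B ≡ 0
    eq rewrite filter-none (λ v → ¬? (v ∈? B))
                 (universal (λ v v∉ → v∉ (full v)) (allFin n)) = refl

  -- Fire alone suffices: each spreading phase lowers the covering radius by one, whatever is
  -- selected.
  rounds-within : ∀ k p B → (∀ v → ∃ λ u → u ∈ B × Within G k v u) → rounds G p B ≤ k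
  rounds-within zero p B cover = ≤-reflexive (rounds-full p B λ v → burned (cover v))
    where
    burned : ∀ {v} → (∃ λ u → u ∈ B × Within G 0 v u) → v ∈ B
    burned (_ , v∈B , here) = v∈B
  rounds-within (suc k) p B cover = rounds-≤ p B λ s →
    rounds-within k (opponent p) _ λ v → next s (cover v)
    where
    next : ∀ s {v} → (∃ λ u → u ∈ B × Within G (suc k) v u) →
           ∃ λ u → u ∈ spread G B ∪ ⁅ s ⁆ × Within G k v u
    -- Reversed, the walk starts at the burning `u`, so the far end of its first edge catches fire.
    next s (u , u∈B , p) with within-sym p
    ... | here     = u , p⊆p∪q ⁅ s ⁆ (spread-⊇ G B u∈B) , here
    ... | step e q = _ , p⊆p∪q ⁅ s ⁆ (spread-~ B u∈B e) , within-sym q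

  firstRound : ∀ {m} → (∀ v B → v ∈ B → rounds G burner B ≤ m) →
               gameBurningNumber′ G ≤ suc m
  firstRound h = rounds-≤ staller ⊥ λ v → h v _ (q⊆p∪q (spread G ⊥) ⁅ v ⁆ (x∈⁅x⁆ v))

  gameBurningNumber′-diameter : ∀ {k} → (∀ u v → Within G k u v) →
                                gameBurningNumber′ G ≤ suc k
  gameBurningNumber′-diameter {k} diam = firstRound λ v B v∈B →
    rounds-within k burner B λ u → v , v∈B , diam u v

  gameBurningNumber′-balls : ∀ {k} →
    (∀ v → ∃₂ λ c₁ c₂ → ∀ u → Within G k u v ⊎ Within G k u c₁ ⊎ Within G k u c₂) →
    gameBurningNumber′ G ≤ 4 + k
  gameBurningNumber′-balls {k} balls = firstRound λ v B v∈B →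
    let c₁ , c₂ , cover = balls v in
    -- Rounds 2 to 4: Burner aims at `c₁`, Staller selects some `s`, Burner aims at `c₂`. Together
    -- with round 1 they give the 4 of the bound; the fire then needs `k` more rounds.
    rounds-burner-≤ B c₁ λ B₁ B⊆ c₁∈ → rounds-≤ staller B₁ λ s →
    rounds-burner-≤ _ c₂ λ B₂ B₁′⊆ c₂∈ →
    let B₁⊆ : B₁ ⊆ B₂
        B₁⊆ = B₁′⊆ ∘ p⊆p∪q ⁅ s ⁆ ∘ spread-⊇ G B₁ in
    rounds-within k staller B₂ λ u → burning (B₁⊆ (B⊆ v∈B)) (B₁⊆ c₁∈) c₂∈ (cover u)
    where
    burning : ∀ {u v c₁ c₂ B} → v ∈ B → c₁ ∈ B → c₂ ∈ B →
      Within G k u v ⊎ Within G k u c₁ ⊎ Within G k u c₂ →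
      ∃ λ w → w ∈ B × Within G k u w
    burning v∈ _ _  (inj₁ p)        = _ , v∈ , p
    burning _ c₁∈ _ (inj₂ (inj₁ p)) = _ , c₁∈ , p
    burning _ _ c₂∈ (inj₂ (inj₂ p)) = _ , c₂∈ , p

  -- Breadth-first trees and covering by three balls.

  module BreadthFirst (connected : Connected G) (root : Fin n) where

    distance : ∀ u → ∃ λ k → Within G k u root × ∀ j → Within G j u root → k ≤ j
    distance u with m , p ← star⇒within (connected u root) = least (λ k → within? k u root) m p

    depth : Fin n → ℕ
    depth u = proj₁ (distance u)

    within-depth : ∀ u → Within G (depth u) u root
    within-depth u = proj₁ (proj₂ (distance u))

    depth-≤ : ∀ {j u} → Within G j u root → depth u ≤ j
    depth-≤ {j} {u} = proj₂ (proj₂ (distance u)) j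

    -- The root is its own parent, in accordance with `pred 0 ≡ 0`; so `parent` is total and
    -- ancestors never leave the root once there.
    findParent : ∀ u → ∃ λ w → Within G 1 u w × depth w ≡ pred (depth u)
    findParent u = go refl (within-depth u)
      where
      go : ∀ {k} → depth u ≡ k → Within G k u root →
           ∃ λ w → Within G 1 u w × depth w ≡ pred k
      go eq here = u , here ,
        trans depth≡0 (cong pred (trans (sym depth≡0) eq))
        where
        depth≡0 : depth u ≡ 0
        depth≡0 = ≤-antisym (depth-≤ here) z≤n
      -- `w` is the second vertex of a shortest walk: `p` bounds its depth from above, and a smaller
      -- depth would shorten the walk from `u`.
      go eq (step {w = w} e p) = w , step e here ,
        ≤-antisym (depth-≤ p)
          (s≤s⁻¹ (≤-trans (≤-reflexive (sym eq)) (depth-≤ (step e (within-depth w)))))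

    parent : Fin n → Fin n
    parent u = proj₁ (findParent u)

    ancestor : ℕ → Fin n → Fin n
    ancestor i = _^_ (Fin n) parent i

    within-ancestor : ∀ i u → Within G i u (ancestor i u)
    within-ancestor zero    u = here
    within-ancestor (suc i) u = within-mono (≤-reflexive (+-comm i 1))
      (within-trans (within-ancestor i u) (proj₁ (proj₂ (findParent (ancestor i u)))))

    depth-ancestor : ∀ i u → depth (ancestor i u) ≡ depth u ∸ i
    depth-ancestor zero    u = refl
    depth-ancestor (suc i) u = begin
      depth (parent (ancestor i u)) ≡⟨ proj₂ (proj₂ (findParent (ancestor i u))) ⟩
      pred (depth (ancestor i u))   ≡⟨ cong pred (depth-ancestor i u) ⟩
      pred (depth u ∸ i)            ≡⟨ pred[m∸n]≡m∸[1+n] (depth u) i ⟩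
      depth u ∸ suc i               ∎
      where open ≡-Reasoning

    ancestor-∸ : ∀ {i r} u → i ≤ r → ancestor (r ∸ i) (ancestor i u) ≡ ancestor r u
    ancestor-∸ {i} {r} u i≤r = trans
      (sym (cong-app (^-homo (Fin n) parent (r ∸ i) i) u))
      (cong (λ k → ancestor k u) (m∸n+n≡m i≤r))

    -- The common ancestor x has one depth, so b is at most as far below x as a.
    paths-meet : ∀ {a b i j r} → i ≤ r → j ≤ depth b → depth b ≤ depth a →
                 ancestor i a ≡ ancestor j b → Within G r b (ancestor r a)
    paths-meet {a} {b} {i} {j} {r} i≤r j≤b b≤a eq =
      within-mono j+[r∸i]≤r (within-trans (within-ancestor j b)
        (subst (Within G (r ∸ i) (ancestor j b))
          (trans (cong (ancestor (r ∸ i)) (sym eq)) (ancestor-∸ a i≤r))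
          (within-ancestor (r ∸ i) (ancestor j b))))
      where
      depths : depth a ∸ i ≡ depth b ∸ j
      depths = trans (sym (depth-ancestor i a)) (trans (cong depth eq) (depth-ancestor j b))

      j≤i : j ≤ i
      j≤i with j ≤? i
      ... | yes j≤i = j≤i
      ... | no  j≰i = contradiction (sym depths) (<⇒≢
        (<-≤-trans (∸-monoʳ-< (≰⇒> j≰i) j≤b) (∸-monoˡ-≤ i b≤a)))

      j+[r∸i]≤r : j + (r ∸ i) ≤ r
      j+[r∸i]≤r = ≤-trans (+-monoˡ-≤ (r ∸ i) j≤i) (≤-reflexive (m+[n∸m]≡n i≤r))

    -- Pigeonhole on the pairs (path, position): two paths that shared a vertex would, by
    -- `paths-meet`, put the later `w j` into the ball around the `r`-th ancestor of `w i`.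
    disjoint-paths : ∀ {m r} (w : Fin m → Fin n) → (∀ i → r ≤ depth (w i)) →
      (∀ i j → i Fin.< j →
        depth (w j) ≤ depth (w i) × ¬ Within G r (w j) (ancestor r (w i))) →
      m * suc r ≤ n
    disjoint-paths {m} {r} w deep separated = ≮⇒≥ λ n<m*[1+r] →
      let s , t , s<t , eq = pigeonhole n<m*[1+r] (vertex ∘ remQuot (suc r)) in
      Fin.<⇒≢ s<t (begin
        s                                         ≡⟨ combine-remQuot {m} (suc r) s ⟨
        uncurry combine (remQuot {m} (suc r) s)   ≡⟨ cong (uncurry combine) (injective _ _ eq) ⟩
        uncurry combine (remQuot {m} (suc r) t)   ≡⟨ combine-remQuot {m} (suc r) t ⟩
        t                                         ∎)
      where
      open ≡-Reasoning

      vertex : Fin m × Fin (suc r) → Fin n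
      vertex (i , k) = ancestor (toℕ k) (w i)

      shallow : ∀ i (k : Fin (suc r)) → toℕ k ≤ depth (w i)
      shallow i k = ≤-trans (toℕ≤pred[n] k) (deep i)

      apart : ∀ i j k l → i Fin.< j → vertex (i , k) ≢ vertex (j , l)
      apart i j k l i<j eq with closer , far ← separated i j i<j =
        far (paths-meet (toℕ≤pred[n] k) (shallow j l) closer eq)

      injective : ∀ x y → vertex x ≡ vertex y → x ≡ y
      injective (i , k) (j , l) eq with Fin.<-cmp i j
      ... | tri< i<j _ _ = contradiction eq (apart i j k l i<j)
      ... | tri> _ _ j<i = contradiction (sym eq) (apart j i l k j<i)
      -- Positions on one path differ in depth, since `r ≤ depth (w i)` keeps the subtraction from
      -- being cut off at 0.
      ... | tri≈ _ refl _ = cong (i ,_) (toℕ-injective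
        (∸-cancelˡ-≡ (shallow i k) (shallow i l)
          (trans (sym (depth-ancestor (toℕ k) (w i)))
            (trans (cong depth eq) (depth-ancestor (toℕ l) (w i))))))

    coveringBalls : ∀ {r} → n < 3 * suc r →
      ∃₂ λ c₁ c₂ → ∀ u → Within G r u root ⊎ Within G r u c₁ ⊎ Within G r u c₂
    coveringBalls {r} n<3[1+r] with maximal depth (λ u → ¬? (within? r u root))
    -- When the search stops early, `root` fills the places of the remaining centres.
    ... | inj₁ none = root , root , λ u →
      inj₁ (decidable-stable (within? r u root) (none u))
    ... | inj₂ (w₁ , far₁ , max₁)
        with maximal depth (λ u → ¬? (within? r u root) ×-dec ¬? (within? r u (ancestor r w₁)))
    ...   | inj₁ none = ancestor r w₁ , root , cover
      where
      cover : ∀ u → Within G r u root ⊎ Within G r u (ancestor r w₁) ⊎ Within G r u root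
      cover u with within? r u root | within? r u (ancestor r w₁)
      ... | yes p | _     = inj₁ p
      ... | no _  | yes q = inj₂ (inj₁ q)
      ... | no ¬p | no ¬q = contradiction (¬p , ¬q) (none u)
    ...   | inj₂ (w₂ , (far₂ , far₂₁) , max₂) = ancestor r w₁ , ancestor r w₂ , cover
      where
      deep : ∀ {u} → ¬ Within G r u root → r ≤ depth u
      deep {u} far = ≰⇒≥ λ d≤r → far (within-mono d≤r (within-depth u))

      -- Each chosen vertex was deepest among those uncovered at its time, hence at least as deep as
      -- any later one; this is the order `disjoint-paths` asks for.
      crowded : ∀ {w₃} → ¬ Within G r w₃ root → ¬ Within G r w₃ (ancestor r w₁) →
                ¬ Within G r w₃ (ancestor r w₂) → 3 * suc r ≤ n
      crowded {w₃} far₃ far₃₁ far₃₂ = disjoint-paths w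
        (λ { zero → deep far₁ ; (suc zero) → deep far₂ ; (suc (suc zero)) → deep far₃ })
        λ { zero (suc zero)             _ → max₁ w₂ far₂ , far₂₁
          ; zero (suc (suc zero))       _ → max₁ w₃ far₃ , far₃₁
          ; (suc zero) (suc (suc zero)) _ → max₂ w₃ (far₃ , far₃₁) , far₃₂
          ; (suc zero) (suc zero) (s≤s ())
          ; (suc (suc zero)) (suc zero) (s≤s ())
          ; (suc (suc zero)) (suc (suc zero)) (s≤s (s≤s ())) }
        where
        w : Fin 3 → Fin n
        w zero             = w₁
        w (suc zero)       = w₂
        w (suc (suc zero)) = w₃

      cover : ∀ u → Within G r u root ⊎
                    Within G r u (ancestor r w₁) ⊎ Within G r u (ancestor r w₂)
      cover u with within? r u root | within? r u (ancestor r w₁) | within? r u (ancestor r w₂)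
      ... | yes p | _     | _     = inj₁ p
      ... | no _  | yes q | _     = inj₂ (inj₁ q)
      ... | no _  | no _  | yes q = inj₂ (inj₂ q)
      ... | no ¬p | no ¬q | no ¬r = contradiction (crowded ¬p ¬q ¬r) (<⇒≱ n<3[1+r])

  -- Radius `n / 3` is large enough for `coveringBalls`. The factor 3 stays on the left because it
  -- stands for the other factor of the final product.
  3*gameBurningNumber′-≤ : Connected G → 3 * gameBurningNumber′ G ≤ n + 12
  3*gameBurningNumber′-≤ connected = begin
    3 * gameBurningNumber′ G ≤⟨ *-monoʳ-≤ 3 (gameBurningNumber′-balls λ v →
                                 BreadthFirst.coveringBalls connected v n<3[1+n/3]) ⟩
    3 * (4 + n / 3)          ≡⟨ *-distribˡ-+ 3 4 (n / 3) ⟩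
    12 + 3 * (n / 3)         ≡⟨ cong (12 +_) (*-comm 3 (n / 3)) ⟩
    12 + n / 3 * 3           ≤⟨ +-monoʳ-≤ 12 (m/n*n≤m n 3) ⟩
    12 + n                   ≡⟨ +-comm 12 n ⟩
    n + 12                   ∎
    where
    open ≤-Reasoning
    n<3[1+n/3] : n < 3 * suc (n / 3)
    n<3[1+n/3] = begin-strict
      n                      ≡⟨ m≡m%n+[m/n]*n n 3 ⟩
      n % 3 + n / 3 * 3      <⟨ +-monoˡ-< (n / 3 * 3) (m%n<n n 3) ⟩
      suc (n / 3) * 3        ≡⟨ *-comm (suc (n / 3)) 3 ⟩
      3 * suc (n / 3)        ∎

-- Diameters of complementary graphs and the product bound.

Diameter≤ : ∀ {n} → ℕ → Graph n → Set
Diameter≤ k G = ∀ u v → Within G k u v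

-- If `u` and `v` are at distance above 2 in `H`, they are adjacent in `K` and have no common
-- neighbor in `H`, so every other vertex is adjacent in `K` to one of them. Only an implication
-- links `H` and `K`, as the double complement is not definitionally the original graph.
diameters : ∀ {n} (H K : Graph n) →
  (∀ {u v} → u ≢ v → ¬ Graph._~_ H u v → Graph._~_ K u v) →
  Diameter≤ 2 H ⊎ Diameter≤ 3 K
diameters {n} H K compl with all? (λ u → all? (within? {G = H} 2 u))
... | yes diam = inj₁ diam
... | no ¬diam
    with u , ¬diamᵤ ← ¬∀⟶∃¬ n _ (λ u → all? (within? {G = H} 2 u)) ¬diam
    with v , far ← ¬∀⟶∃¬ n _ (within? {G = H} 2 u) ¬diamᵤ = inj₂ λ x y → route (near x) (near y)
  where
  open Graph H

  u~v : Graph._~_ K u v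
  u~v = compl (λ { refl → far here }) (λ e → far (step e here))

  near : ∀ x → Within K 1 x u ⊎ Within K 1 x v
  near x with x ≟ u | x ≟ v | u ~? x | x ~? v
  ... | yes refl | _ | _ | _ = inj₁ here
  ... | no _ | yes refl | _ | _ = inj₂ here
  ... | no x≢u | no _ | no u≁x | _ = inj₁ (step (compl x≢u (u≁x ∘ ~-sym)) here)
  ... | no _ | no x≢v | yes _ | no x≁v = inj₂ (step (compl x≢v x≁v) here)
  ... | no _ | no _ | yes u~x | yes x~v = contradiction (step u~x (step x~v here)) far

  join : ∀ {x y a b} → Within K 1 x a → Within K 1 a b → Within K 1 y b → Within K 3 x y
  join p q p′ = within-trans p (within-trans q (within-sym p′))

  route : ∀ {x y} → Within K 1 x u ⊎ Within K 1 x v → Within K 1 y u ⊎ Within K 1 y v →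
          Within K 3 x y
  route (inj₁ p) (inj₁ q) = join p here q
  route (inj₁ p) (inj₂ q) = join p (step u~v here) q
  route (inj₂ p) (inj₁ q) = join p (step (Graph.~-sym K u~v) here) q
  route (inj₂ p) (inj₂ q) = join p here q

corollary15 : ∀ (n : ℕ) → 3 ≤ n → (G : Graph n) → Connected G → Connected (complement G) →
    gameBurningNumber′ G * gameBurningNumber′ (complement G) ≤ n + 21
corollary15 n _ G connected connectedᶜ
  with diameters G (complement G) (λ u≢v u≁v → u≢v , u≁v)
     | diameters (complement G) G (λ {u} {v} u≢v ¬e →
         decidable-stable (Graph._~?_ G u v) (λ u≁v → ¬e (u≢v , u≁v)))
-- Diameter at most 2 makes this factor at most 3; the other one, tripled, is at most `n + 12`.
... | inj₁ diam₂ | _ = ≤-trans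
      (*-monoˡ-≤ (gameBurningNumber′ (complement G)) (gameBurningNumber′-diameter G diam₂))
      (≤-trans (3*gameBurningNumber′-≤ (complement G) connectedᶜ) (+-monoʳ-≤ n (m≤m+n 12 9)))
... | inj₂ _ | inj₁ diam₂ = ≤-trans
      (*-monoʳ-≤ (gameBurningNumber′ G) (gameBurningNumber′-diameter (complement G) diam₂))
      (≤-trans (≤-reflexive (*-comm (gameBurningNumber′ G) 3))
        (≤-trans (3*gameBurningNumber′-≤ G connected) (+-monoʳ-≤ n (m≤m+n 12 9))))
-- Both factors are at most 4, and 16 is below `n + 21`.
... | inj₂ diamᶜ | inj₂ diam = ≤-trans
      (*-mono-≤ (gameBurningNumber′-diameter G diam)
                (gameBurningNumber′-diameter (complement G) diamᶜ))
      (≤-trans (m≤m+n 16 5) (m≤n+m 21 n))
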